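{- Let $k\ge 2$ and let $G$ be a graph admitting an acyclic $k$-coloring. Then $\chi_s(G)\le k\cdot 2^{k-2}$.
   Context: An acyclic $k$-coloring of a graph is a proper vertex coloring with $k$ colors in which every cycle receives at least three colors (any two color classes induce a forest). A signified graph $(G,\Sigma)$ is a graph $G$ with a set $\Sigma\subseteq E(G)$ of negative edges, other edges positive. Resigning $X\subseteq V(G)$ changes the sign of exactly the edges with one endpoint in $X$; two signified graphs on $G$ are equivalent if one is obtained from the other by resigning. A signified homomorphism is a vertex map sending each edge to an edge of the same sign; a signed homomorphism of $(G,\Sigma)$ to $(H,\Lambda)$ is a signified homomorphism between some signified graphs equivalent to $(G,\Sigma)$ and $(H,\Lambda)$. $\chi_s(G,\Sigma)$ is the minimum number of vertices of a signified graph to which $(G,\Sigma)$ admits a signed homomorphism, and $\chi_s(G)=\max_{\Sigma\subseteq E(G)}\chi_s(G,\Sigma)$. -}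

module Defs where

open import Data.Bool using (Bool; true; false; T; _∧_; _∨_; _xor_)
open import Data.Bool.Properties
  using (T-∧; T-∨; T-≡; T?; ∨-comm; ∨-idem; xor-comm; xor-identityʳ)
  renaming (_≟_ to _≟ᵇ_)
open import Data.Empty using (⊥-elim)
open import Data.Fin using (Fin; combine; remQuot; finToFun; funToFin)
open import Data.Fin.Properties using (_≟_; all?; any?; remQuot-combine; finToFun-funToFin)
open import Data.Fin.Subset using (Subset; ⊥)
open import Data.Fin.Subset.Properties using (anySubset?)
open import Data.List using (List; []; _∷_; _++_; [_]; length)
open import Data.List.Membership.Propositional using (_∈_)
open import Data.List.Relation.Unary.Linked using (Linked)
open import Data.List.Relation.Unary.Unique.Propositional using (Unique)
open import Data.Nat using (ℕ; zero; suc; _≤_; _<_; _*_; z≤n)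
open import Data.Nat.Properties using (≤-antisym; ≤∧≢⇒<; ≤-pred; ≮⇒≥; n<1+n)
  renaming (_≟_ to _≟ⁿ_)
open import Data.Product using (Σ-syntax; ∃; ∃-syntax; _×_; _,_; proj₁; proj₂; uncurry)
open import Data.Sum using (_⊎_; inj₁; inj₂)
open import Data.Vec using (lookup; tabulate)
open import Data.Vec.Properties using (lookup∘tabulate; lookup-replicate)
open import Function using (_∘_; id; _⇔_; mk⇔; Equivalence)
open import Relation.Binary.PropositionalEquality
  using (_≡_; _≢_; refl; sym; trans; cong; cong₂; subst; subst₂)
open import Relation.Nullary using (¬_; Dec; yes; no; does; ¬?; contradiction)
open import Relation.Nullary.Decidable
  using (map′; _×-dec_; _→-dec_; does-⇔; dec-true; dec-false) renaming (map to mapDec)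
open import Relation.Unary using (Pred; Decidable)
open import Level using (0ℓ)

private
  variable
    m n k : ℕ

-- Finite simple graphs on n vertices.  Edge relations are Boolean-valued so
-- that, as is usual for finite graphs, adjacency is decidable.

record Graph (n : ℕ) : Set where
  field
    adj        : Fin n → Fin n → Bool
    adj-sym    : ∀ u v → adj u v ≡ adj v u
    adj-irrefl : ∀ v → adj v v ≡ false

  infix 4 _~_
  _~_ : Fin n → Fin n → Set
  u ~ v = T (adj u v)

open Graph using (adj; adj-sym; adj-irrefl) public

-- The vertices v ∷ vs, in cyclic order; the walk v, vs, v is closed.
record Cycle (G : Graph n) : Set where
  open Graph G using (_~_)
  field
    v        : Fin n
    vs       : List (Fin n)
    long     : 3 ≤ length (v ∷ vs)
    distinct : Unique (v ∷ vs)
    closed   : Linked _~_ (v ∷ vs ++ [ v ])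

  vertices : List (Fin n)
  vertices = v ∷ vs

record AcyclicColoring (G : Graph n) (k : ℕ) : Set where
  open Graph G using (_~_)
  open Cycle using (vertices)
  field
    color   : Fin n → Fin k
    proper  : ∀ {u v} → u ~ v → color u ≢ color v
    acyclic : (C : Cycle G) →
              ∃[ x ] ∃[ y ] ∃[ z ]
                (x ∈ vertices C × y ∈ vertices C × z ∈ vertices C ×
                 color x ≢ color y × color x ≢ color z × color y ≢ color z)

-- A set of (negative) edges of G.
record Signature (G : Graph n) : Set where
  open Graph G using (_~_)
  field
    neg     : Fin n → Fin n → Bool
    neg-sym : ∀ u v → neg u v ≡ neg v u
    neg⊆adj : ∀ {u v} → T (neg u v) → u ~ v

open Signature using (neg; neg-sym; neg⊆adj) public

infix 4 _≐_
_≐_ : {G : Graph n} → Signature G → Signature G → Set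
S ≐ S′ = ∀ u v → neg S u v ≡ neg S′ u v

resign : {G : Graph n} → Subset n → Signature G → Signature G
resign {G = G} X S = record
  { neg     = λ u v → adj G u v ∧ (neg S u v xor (lookup X u xor lookup X v))
  ; neg-sym = λ u v → cong₂ _∧_ (adj-sym G u v)
                        (cong₂ _xor_ (neg-sym S u v) (xor-comm (lookup X u) (lookup X v)))
  ; neg⊆adj = proj₁ ∘ Equivalence.to T-∧
  }

Equivalent : {G : Graph n} → Signature G → Signature G → Set
Equivalent S S′ = ∃[ X ] S′ ≐ resign X S

record SignifiedHom {G : Graph n} {H : Graph m} (S : Signature G) (L : Signature H) : Set where
  open Graph G using () renaming (_~_ to _~ᴳ_)
  open Graph H using () renaming (_~_ to _~ᴴ_)
  field
    map      : Fin n → Fin m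
    map-edge : ∀ {u v} → u ~ᴳ v → map u ~ᴴ map v
    map-sign : ∀ {u v} → u ~ᴳ v → neg L (map u) (map v) ≡ neg S u v

SignedHom : {G : Graph n} {H : Graph m} → Signature G → Signature H → Set
SignedHom {G = G} {H} S L =
  Σ[ S′ ∈ Signature G ] Σ[ L′ ∈ Signature H ]
    (Equivalent S S′ × Equivalent L L′ × SignifiedHom S′ L′)

MapsToOrder : {G : Graph n} → Signature G → Pred ℕ 0ℓ
MapsToOrder S m = Σ[ H ∈ Graph m ] Σ[ L ∈ Signature H ] SignedHom S L

IsMinimum IsMaximum : Pred ℕ 0ℓ → ℕ → Set
IsMinimum P m = P m × (∀ j → P j → m ≤ j)
IsMaximum P m = P m × (∀ j → P j → j ≤ m)

------------------------------------------------------------------------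
-- The minimum and the maximum in the definition of χₛ exist because they
-- range over decidable, suitably bounded sets; the lemmas up to
-- `minimumOrder` establish this for χₛ(G,Σ).

minimum : {P : Pred ℕ 0ℓ} → Decidable P → ∃ P → ∃ (IsMinimum P)
minimum {P} P? (b , Pb) with below (suc b)
  where
  below : ∀ b → ∃ (IsMinimum P) ⊎ (∀ {j} → j < b → ¬ P j)
  below zero    = inj₂ λ ()
  below (suc b) with below b
  ... | inj₁ found = inj₁ found
  ... | inj₂ none with P? b
  ...   | yes Pb = inj₁ (b , Pb , λ j Pj → ≮⇒≥ λ j<b → none j<b Pj)
  ...   | no ¬Pb = inj₂ below-suc
    where
    below-suc : ∀ {j} → j < suc b → ¬ P j
    below-suc {j} j<1+b Pj with j ≟ⁿ b
    ... | yes refl = ¬Pb Pj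
    ... | no  j≢b  = none (≤∧≢⇒< (≤-pred j<1+b) j≢b) Pj
... | inj₁ found = found
... | inj₂ none  = contradiction Pb (none (n<1+n b))

maximum : {P : Pred ℕ 0ℓ} → Decidable P → ∃ P → ∀ b → (∀ j → P j → j ≤ b) → ∃ (IsMaximum P)
maximum P? (w , Pw) b bound with P? b
... | yes Pb = b , Pb , bound
maximum P? (w , Pw) zero    bound | no ¬Pb with bound w Pw
... | z≤n = contradiction Pw ¬Pb
maximum {P} P? (w , Pw) (suc b) bound | no ¬Pb = maximum P? (w , Pw) b bound′
  where
  bound′ : ∀ j → P j → j ≤ b
  bound′ j Pj with j ≟ⁿ suc b
  ... | yes refl = contradiction Pj ¬Pb
  ... | no  j≢   = ≤-pred (≤∧≢⇒< (bound j Pj) j≢)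

T-injective : ∀ {x y} → (T x → T y) → (T y → T x) → x ≡ y
T-injective {false} {false} f g = refl
T-injective {false} {true}  f g = ⊥-elim (g _)
T-injective {true}  {false} f g = ⊥-elim (f _)
T-injective {true}  {true}  f g = refl

resign-edge : {G : Graph n} (X : Subset n) (S : Signature G) → ∀ {u v} → Graph._~_ G u v →
              neg (resign X S) u v ≡ neg S u v xor (lookup X u xor lookup X v)
resign-edge {G = G} X S {u} {v} u~v rewrite Equivalence.to T-≡ u~v = refl

resign-⊥ : {G : Graph n} (S : Signature G) → S ≐ resign ⊥ S
resign-⊥ {n} {G} S u v = T-injective
  (λ s → subst T (sym (trans (resign-edge {G = G} ⊥ S (neg⊆adj S s)) same)) s)
  (λ s → subst T (trans (resign-edge {G = G} ⊥ S (neg⊆adj (resign ⊥ S) s)) same) s)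
  where
  same : neg S u v xor (lookup ⊥ u xor lookup ⊥ v) ≡ neg S u v
  same rewrite lookup-replicate u false | lookup-replicate v false = xor-identityʳ _

Equivalent-refl : {G : Graph n} (S : Signature G) → Equivalent S S
Equivalent-refl S = ⊥ , resign-⊥ S

MapsToOrder-resp : {G : Graph n} {S S′ : Signature G} → S ≐ S′ →
                   MapsToOrder S m → MapsToOrder S′ m
MapsToOrder-resp {G = G} S≐S′ (H , L , S₁ , L₁ , (X , S₁≐) , L~L₁ , φ) =
  H , L , S₁ , L₁ ,
  (X , λ u v → trans (S₁≐ u v)
                 (cong (λ s → adj G u v ∧ (s xor (lookup X u xor lookup X v))) (S≐S′ u v))) ,
  L~L₁ , φ

mapsToSelf : {G : Graph n} (S : Signature G) → MapsToOrder S n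
mapsToSelf {G = G} S = G , S , S , S , Equivalent-refl S , Equivalent-refl S ,
  record { map = id ; map-edge = id ; map-sign = λ _ → refl }

-- The condition for f to be a signified homomorphism from S to some
-- signified graph, which can then be taken to be the image of f.
Compatible : {G : Graph n} → Signature G → (Fin n → Fin m) → Set
Compatible {G = G} S f =
  (∀ u v → u ~ v → f u ≢ f v) ×
  (∀ u v u′ v′ → u ~ v → u′ ~ v′ → f u ≡ f u′ → f v ≡ f v′ → neg S u v ≡ neg S u′ v′)
  where open Graph G using (_~_)

compatible? : {G : Graph n} (S : Signature G) (f : Fin n → Fin m) → Dec (Compatible S f)
compatible? {G = G} S f =
  (all? λ u → all? λ v → T? (adj G u v) →-dec ¬? (f u ≟ f v)) ×-dec
  (all? λ u → all? λ v → all? λ u′ → all? λ v′ →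
    T? (adj G u v) →-dec (T? (adj G u′ v′) →-dec
    ((f u ≟ f u′) →-dec ((f v ≟ f v′) →-dec (neg S u v ≟ᵇ neg S u′ v′)))))

Compatible-resp : {G : Graph n} {S : Signature G} {f g : Fin n → Fin m} →
                  (∀ u → f u ≡ g u) → Compatible S f → Compatible S g
Compatible-resp f≗g (proper , signs) =
  (λ u v e q → proper u v e (trans (f≗g u) (trans q (sym (f≗g v))))) ,
  (λ u v u′ v′ e e′ p q → signs u v u′ v′ e e′
    (trans (f≗g u) (trans p (sym (f≗g u′)))) (trans (f≗g v) (trans q (sym (f≗g v′)))))

Image : (Fin n → Fin n → Bool) → (Fin n → Fin m) → Fin m → Fin m → Set
Image r f a b = ∃[ u ] ∃[ v ] (T (r u v) × f u ≡ a × f v ≡ b)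

image? : (r : Fin n → Fin n → Bool) (f : Fin n → Fin m) → ∀ a b → Dec (Image r f a b)
image? r f a b = any? λ u → any? λ v → T? (r u v) ×-dec ((f u ≟ a) ×-dec (f v ≟ b))

image : (Fin n → Fin n → Bool) → (Fin n → Fin m) → Fin m → Fin m → Bool
image r f a b = does (image? r f a b)

image⁺ : ∀ r (f : Fin n → Fin m) {a b} → Image r f a b → T (image r f a b)
image⁺ r f {a} {b} i = Equivalence.from T-≡ (dec-true (image? r f a b) i)

image⁻ : ∀ r (f : Fin n → Fin m) {a b} → T (image r f a b) → Image r f a b
image⁻ r f {a} {b} t with image? r f a b
... | yes i = i

image-sym : ∀ r (f : Fin n → Fin m) → (∀ u v → r u v ≡ r v u) →
            ∀ a b → image r f a b ≡ image r f b a
image-sym r f r-sym a b = does-⇔ (mk⇔ swap swap) (image? r f a b) (image? r f b a)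
  where
  swap : ∀ {a b} → Image r f a b → Image r f b a
  swap (u , v , t , p , q) = v , u , subst T (r-sym u v) t , q , p

imageGraph : {G : Graph n} (S : Signature G) (f : Fin n → Fin m) → Compatible S f → Graph m
imageGraph {G = G} S f (proper , _) = record
  { adj        = image (adj G) f
  ; adj-sym    = image-sym (adj G) f (adj-sym G)
  ; adj-irrefl = λ a → dec-false (image? (adj G) f a a)
                   λ (u , v , e , p , q) → proper u v e (trans p (sym q))
  }

imageSignature : {G : Graph n} (S : Signature G) (f : Fin n → Fin m) (c : Compatible S f) →
                 Signature (imageGraph S f c)
imageSignature {G = G} S f c = record
  { neg     = image (neg S) f
  ; neg-sym = image-sym (neg S) f (neg-sym S)
  ; neg⊆adj = λ t → let (u , v , s , pq) = image⁻ (neg S) f t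
                    in image⁺ (adj G) f (u , v , neg⊆adj S s , pq)
  }

imageHom : {G : Graph n} (S : Signature G) (f : Fin n → Fin m) (c : Compatible S f) →
           SignifiedHom S (imageSignature S f c)
imageHom {G = G} S f c = record
  { map      = f
  ; map-edge = λ {u} {v} e → image⁺ (adj G) f (u , v , e , refl , refl)
  ; map-sign = λ {u} {v} e → T-injective
      (λ t → let (u′ , v′ , s , p , q) = image⁻ (neg S) f t
             in subst T (proj₂ c u′ v′ u v (neg⊆adj S s) e p q) s)
      (λ s → image⁺ (neg S) f (u , v , s , refl , refl))
  }

mapsToOrder⇔ : {G : Graph n} (S : Signature G) →
               (∃[ X ] ∃[ i ] Compatible (resign X S) (finToFun {m} {n} i)) ⇔ MapsToOrder S m
mapsToOrder⇔ {n} {m} {G} S = mk⇔ to from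
  where
  to : (∃[ X ] ∃[ i ] Compatible (resign X S) (finToFun i)) → MapsToOrder S m
  to (X , i , c) =
    imageGraph (resign X S) f c , L , resign X S , L ,
    (X , λ _ _ → refl) , Equivalent-refl L , imageHom (resign X S) f c
    where
    f = finToFun i
    L = imageSignature (resign X S) f c

  from : MapsToOrder S m → ∃[ X ] ∃[ i ] Compatible (resign X S) (finToFun i)
  from (H , L , S′ , L′ , (X , S′≐) , _ , φ) = X , funToFin map ,
    Compatible-resp {G = G} {S = resign X S} (λ u → sym (finToFun-funToFin map u)) (proper , signs)
    where
    open SignifiedHom φ
    open Graph G using (_~_)
    proper : ∀ u v → u ~ v → map u ≢ map v
    proper u v e q = subst T
      (trans (cong (λ a → adj H a (map v)) q) (adj-irrefl H (map v))) (map-edge e)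
    sign : ∀ {u v} → u ~ v → neg (resign X S) u v ≡ neg L′ (map u) (map v)
    sign {u} {v} e = trans (sym (S′≐ u v)) (sym (map-sign e))
    signs : ∀ u v u′ v′ → u ~ v → u′ ~ v′ → map u ≡ map u′ → map v ≡ map v′ →
            neg (resign X S) u v ≡ neg (resign X S) u′ v′
    signs u v u′ v′ e e′ p q =
      trans (sign e) (trans (cong₂ (neg L′) p q) (sym (sign e′)))

mapsToOrder? : {G : Graph n} (S : Signature G) → Decidable (MapsToOrder S)
mapsToOrder? S m = mapDec (mapsToOrder⇔ S)
  (anySubset? λ X → any? λ i → compatible? (resign X S) (finToFun i))

minimumOrder : {G : Graph n} (S : Signature G) → ∃ (IsMinimum (MapsToOrder S))
minimumOrder {n} S = minimum (mapsToOrder? S) (n , mapsToSelf S)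

------------------------------------------------------------------------

-- χₛ(G,Σ)
χₛ-signed : {G : Graph n} → Signature G → ℕ
χₛ-signed S = proj₁ (minimumOrder S)

χₛ-signed-isMinimum : {G : Graph n} (S : Signature G) →
                      IsMinimum (MapsToOrder S) (χₛ-signed S)
χₛ-signed-isMinimum S = proj₂ (minimumOrder S)

χₛ-signed-resp : {G : Graph n} {S S′ : Signature G} → S ≐ S′ → χₛ-signed S ≡ χₛ-signed S′
χₛ-signed-resp {G = G} {S} {S′} eq = ≤-antisym (le eq) (le λ u v → sym (eq u v))
  where
  le : {S S′ : Signature G} → S ≐ S′ → χₛ-signed S ≤ χₛ-signed S′
  le {S} {S′} eq = proj₂ (χₛ-signed-isMinimum S) _
    (MapsToOrder-resp {S = S′} {S′ = S} (λ u v → sym (eq u v)) (proj₁ (χₛ-signed-isMinimum S′)))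

-- Every subset of Fin (n * n) ≅ Fin n × Fin n is turned into a signature,
-- and every signature arises in this way.
fromSubset : {G : Graph n} → Subset (n * n) → Signature G
fromSubset {n} {G} A = record
  { neg     = λ u v → adj G u v ∧ (inA u v ∨ inA v u)
  ; neg-sym = λ u v → cong₂ _∧_ (adj-sym G u v) (∨-comm (inA u v) (inA v u))
  ; neg⊆adj = proj₁ ∘ Equivalence.to T-∧
  }
  where
  inA : Fin n → Fin n → Bool
  inA u v = lookup A (combine u v)

toSubset : {G : Graph n} → Signature G → Subset (n * n)
toSubset {n} S = tabulate (uncurry (neg S) ∘ remQuot n)

lookup-toSubset : {G : Graph n} (S : Signature G) → ∀ u v →
                  lookup (toSubset S) (combine u v) ≡ neg S u v
lookup-toSubset {n} S u v =
  trans (lookup∘tabulate (uncurry (neg S) ∘ remQuot n) (combine u v))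
        (cong (uncurry (neg S)) (remQuot-combine u v))

fromSubset-toSubset : {G : Graph n} (S : Signature G) → fromSubset (toSubset S) ≐ S
fromSubset-toSubset S u v
  rewrite lookup-toSubset S u v | lookup-toSubset S v u | neg-sym S v u | ∨-idem (neg S u v) =
  T-injective (proj₂ ∘ Equivalence.to T-∧) (λ s → Equivalence.from T-∧ (neg⊆adj S s , s))

IsValue : Graph n → Pred ℕ 0ℓ
IsValue G c = Σ[ S ∈ Signature G ] χₛ-signed S ≡ c

isValue? : (G : Graph n) → Decidable (IsValue G)
isValue? G c = map′
  (λ (A , q) → fromSubset A , q)
  (λ (S , q) → toSubset S , trans (χₛ-signed-resp (fromSubset-toSubset S)) q)
  (anySubset? λ A → χₛ-signed (fromSubset {G = G} A) ≟ⁿ c)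

maximumValue : (G : Graph n) → ∃ (IsMaximum (IsValue G))
maximumValue {n} G = maximum (isValue? G) (_ , fromSubset ⊥ , refl) n bound
  where
  bound : ∀ j → IsValue G j → j ≤ n
  bound _ (S , refl) = proj₂ (χₛ-signed-isMinimum S) n (mapsToSelf S)

-- χₛ(G), the maximum of χₛ(G,Σ) over all Σ ⊆ E(G)
χₛ : Graph n → ℕ
χₛ G = proj₁ (maximumValue G)

χₛ-isMaximum : (G : Graph n) → IsMaximum (IsValue G) (χₛ G)
χₛ-isMaximum G = proj₂ (maximumValue G)

{-# OPTIONS --safe #-}
-- Two colour classes i, j induce a forest, on which every signature is a
-- coboundary: the edge uv has sign h i j u xor h i j v.  (Insert the edges one
-- by one; each joins two components, and h may be flipped on one of them.)  Hence the colour i of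
-- a vertex u together with the k − 1 bits h i j u, j ≠ i, determines a signified
-- homomorphism.  Resigning at u according to one of these bits adds that bit to
-- all of them, so that it becomes constantly zero and k − 2 bits remain.

module Submission where

open import Defs
open import Data.Bool using (Bool; true; false; T; if_then_else_; _∧_; _∨_; _xor_)
open import Data.Bool.Properties using (T-∧; T-∨; T-≡; T?; ∧-comm; ∧-identityʳ; xor-comm; xor-same)
open import Data.Bool.Solver using (module xor-∧-Solver)
open import Data.Empty using (⊥-elim)
open import Data.Fin using (Fin; zero; suc; punchIn; punchOut; combine; funToFin; finToFun)
open import Data.Fin.Properties
  using (_≟_; _<?_; <-cmp; 2↔Bool; combine-injective; finToFun-funToFin; punchIn-punchOut)
open import Data.Fin.Subset using (Subset)
open import Data.List using (List; []; _∷_; _++_; [_]; allFin; cartesianProduct)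
open import Data.List.Membership.Propositional using (_∈_)
open import Data.List.Membership.Propositional.Properties
  using (∈-allFin; ∈-cartesianProduct⁺; ∈-filter⁺)
import Data.List.Membership.DecPropositional as DecMembership
open import Data.List.Relation.Unary.All as All using (All; []; _∷_)
open import Data.List.Relation.Unary.All.Properties using (¬Any⇒All¬; all-filter)
open import Data.List.Relation.Unary.Any using (here; there)
open import Data.List.Relation.Unary.AllPairs using ([]; _∷_)
open import Data.List.Relation.Unary.Linked as Linked using (Linked; []; [-]; _∷_)
open import Data.List.Relation.Unary.Unique.Propositional using (Unique)
open import Data.Nat using (ℕ; suc; _≤_; _+_; _*_; _^_; _∸_; z≤n; s≤s)
open import Data.Product using (∃; ∃-syntax; _×_; _,_; proj₁; proj₂; uncurry)
open import Data.Sum using (_⊎_; inj₁; inj₂; [_,_]′)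
open import Data.Vec using (tabulate; lookup)
open import Data.Vec.Properties using (lookup∘tabulate)
open import Function using (_∘_; Equivalence; Inverse)
open import Relation.Binary using (Rel; tri<; tri≈; tri>)
open import Relation.Binary.Construct.Closure.Equivalence as EqClosure using (EqClosure)
open import Relation.Binary.Construct.Closure.ReflexiveTransitive using (Star; ε; _◅_; _◅◅_)
open import Relation.Binary.Construct.Closure.Symmetric using (SymClosure; fwd; bwd)
open import Relation.Binary.PropositionalEquality
  using (_≡_; _≢_; refl; sym; trans; cong; cong₂; subst; module ≡-Reasoning)
open import Relation.Nullary using (¬_; yes; no; does; contradiction)
open import Relation.Nullary.Decidable using (dec-true; dec-false)
open import Level using (0ℓ)

private
  variable
    n k : ℕ

-- Walks and simple paths

module _ {A : Set} {R : Rel A 0ℓ} where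

  -- Applied to a closed walk in an induced graph: the edge leaving each vertex certifies that the
  -- vertex belongs to the inducing set.
  linked-init : ∀ xs {y} → Linked R (xs ++ [ y ]) → All (λ x → ∃ (R x)) xs
  linked-init []            l       = []
  linked-init (x ∷ [])      (r ∷ _) = (_ , r) ∷ []
  linked-init (x ∷ x′ ∷ xs) (r ∷ l) = (_ , r) ∷ linked-init (x′ ∷ xs) l

-- Walk R u xs v: the walk u ∷ xs ends at v.
data Walk {A : Set} (R : Rel A 0ℓ) : A → List A → A → Set where
  []  : ∀ {u} → Walk R u [] u
  _∷_ : ∀ {u w xs v} → R u w → Walk R w xs v → Walk R u (w ∷ xs) v

SimplePath : {A : Set} → Rel A 0ℓ → Rel A 0ℓ
SimplePath R u v = ∃[ xs ] (Walk R u xs v × Unique (u ∷ xs))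

module _ {A : Set} {R : Rel A 0ℓ} where

  walk-snoc-linked : ∀ {u xs v y} → Walk R u xs v → R v y → Linked R (u ∷ xs ++ [ y ])
  walk-snoc-linked []      r = r ∷ [-]
  walk-snoc-linked (s ∷ w) r = s ∷ walk-snoc-linked w r

  walk-map : {R′ : Rel A 0ℓ} → (∀ {u v} → R u v → R′ u v) →
             ∀ {u xs v} → Walk R u xs v → Walk R′ u xs v
  walk-map f []      = []
  walk-map f (r ∷ w) = f r ∷ walk-map f w

  suffix : ∀ {u xs v x} → Walk R u xs v → Unique (u ∷ xs) → x ∈ u ∷ xs → SimplePath R x v
  suffix w       uniq       (here refl) = _ , w , uniq
  suffix (_ ∷ w) (_ ∷ uniq) (there x∈)  = suffix w uniq x∈

-- If the new first vertex `u` already lies on the path, only the part from `u` onward is kept, so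
-- repetitions never arise.
star⇒simplePath : {R : Rel (Fin n) 0ℓ} → ∀ {u v} → Star R u v → SimplePath R u v
star⇒simplePath ε = [] , [] , ([] ∷ [])
star⇒simplePath {u = u} (_◅_ {j = w} r rs) with star⇒simplePath rs
... | xs , p , uniq with DecMembership._∈?_ _≟_ u (w ∷ xs)
...   | yes u∈ = suffix p uniq u∈
...   | no  u∉ = w ∷ xs , r ∷ p , ¬Any⇒All¬ _ u∉ ∷ uniq

-- Signatures of forests

module _ (G : Graph n) (acyclic : ¬ Cycle G) (S : Signature G) where
  open Graph G using (_~_)

  private
    Listed : List (Fin n × Fin n) → Rel (Fin n) 0ℓ
    Listed es u v = (u , v) ∈ es

    listed⇒adjacent : ∀ {es} → All (uncurry _~_) es → ∀ {u v} → SymClosure (Listed es) u v → u ~ v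
    listed⇒adjacent es~ (fwd e) = All.lookup es~ e
    listed⇒adjacent es~ {u} {v} (bwd e) = subst T (adj-sym G v u) (All.lookup es~ e)

  -- The labelling of components is that of the union-find algorithm.
  record Potential (es : List (Fin n × Fin n)) : Set where
    field
      potential : Fin n → Bool
      component : Fin n → Fin n
      sign      : ∀ {u v} → (u , v) ∈ es → neg S u v ≡ potential u xor potential v
      joined    : ∀ {u v} → (u , v) ∈ es → component u ≡ component v
      connected : ∀ {u v} → component u ≡ component v → EqClosure (Listed es) u v

    sign-sym : ∀ {u v} → SymClosure (Listed es) u v → neg S u v ≡ potential u xor potential v
    sign-sym (fwd e) = sign e
    sign-sym {u} {v} (bwd e) =
      trans (neg-sym S u v) (trans (sign e) (xor-comm (potential v) (potential u)))

  -- A simple path of length at least two would form a cycle with the edge uv.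
  sign-connected : ∀ {es} → All (uncurry _~_) es → (P : Potential es) → let open Potential P in
                   ∀ {u v} → u ~ v → component u ≡ component v →
                   neg S u v ≡ potential u xor potential v
  sign-connected es~ P {u} {v} u~v same with star⇒simplePath (Potential.connected P same)
  ... | _ , []         , _    = ⊥-elim (subst T (adj-irrefl G u) u~v)
  -- The path is the edge `uv` itself, already listed in one of its orientations.
  ... | _ , (r ∷ [])   , _    = Potential.sign-sym P r
  ... | _ , w@(_ ∷ _ ∷ _) , uniq = contradiction
    (record
      { v = u ; vs = _ ; long = s≤s (s≤s (s≤s z≤n)) ; distinct = uniq
      ; closed = closed w })
    acyclic
    where
    closed : ∀ {xs} → Walk (SymClosure (Listed _)) u xs v → Linked _~_ (u ∷ xs ++ [ u ])
    closed w =
      walk-snoc-linked (walk-map (listed⇒adjacent es~) w) (subst T (adj-sym G u v) u~v)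

  weaken : ∀ {e es u v} → EqClosure (Listed es) u v → EqClosure (Listed (e ∷ es)) u v
  weaken = EqClosure.map there

  potentials : ∀ {es} → All (uncurry _~_) es → Potential es
  potentials [] = record
    { potential = λ _ → false
    ; component = λ u → u
    ; sign      = λ ()
    ; joined    = λ ()
    ; connected = λ { refl → ε }
    }
  potentials {(a , b) ∷ es} (a~b ∷ es~) with potentials es~
  ... | P with Potential.component P a ≟ Potential.component P b
  -- By acyclicity, `ab` is already listed in one of its orientations, so the old data serve
  -- unchanged.
  ... | yes same = record
    { potential = potential
    ; component = component
    ; sign      = λ { (here refl) → sign-connected es~ P a~b same ; (there e) → sign e }
    ; joined    = λ { (here refl) → same ; (there e) → joined e }
    ; connected = weaken ∘ connected
    }
    where open Potential P
  ... | no  differ = record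
    { potential = potential′
    ; component = component′
    ; sign      = λ { (here refl) → sign-ab ; (there e) → sign-old e }
    ; joined    = λ { (here refl) → joined-ab ; (there e) → cong merge (joined e) }
    ; connected = connected′
    }
    where
    open Potential P

    merge : Fin n → Fin n
    merge c = if does (c ≟ component b) then component a else c

    component′ : Fin n → Fin n
    component′ u = merge (component u)

    -- The discrepancy between the sign of `ab` and the old potential. Adding it on the component of
    -- `b` alone repairs `ab`.
    correction : Bool
    correction = neg S a b xor (potential a xor potential b)

    flip : Fin n → Bool
    flip c = does (c ≟ component b) ∧ correction

    potential′ : Fin n → Bool
    potential′ u = potential u xor flip (component u)

    sign-ab : neg S a b ≡ potential′ a xor potential′ b
    sign-ab rewrite dec-false (component a ≟ component b) differ
                  | dec-true (component b ≟ component b) refl =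
      -- `con false` is the flip at `a`, whose component differs from that of `b`; the flip at `b`
      -- is the whole discrepancy.
      solve 3 (λ s x y → s := (x :+ con false) :+ (y :+ (s :+ (x :+ y)))) refl
        (neg S a b) (potential a) (potential b)
      where open xor-∧-Solver

    sign-old : ∀ {u v} → (u , v) ∈ es → neg S u v ≡ potential′ u xor potential′ v
    -- Both ends of an old edge lie in one component, so they receive the same flip and it cancels.
    sign-old {u} {v} e rewrite sign e | joined e =
      solve 3 (λ x y z → x :+ y := (x :+ z) :+ (y :+ z)) refl
        (potential u) (potential v) (flip (component v))
      where open xor-∧-Solver

    joined-ab : component′ a ≡ component′ b
    joined-ab rewrite dec-false (component a ≟ component b) differ
                    | dec-true (component b ≟ component b) refl = refl

    connected′ : ∀ {u v} → component′ u ≡ component′ v → EqClosure (Listed ((a , b) ∷ es)) u v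
    connected′ {u} {v} q with component u ≟ component b | component v ≟ component b
    ... | yes p | yes p′ = weaken (connected (trans p (sym p′)))
    -- If just one of `u`, `v` lies in the old component of `b`, the other lies in that of `a`, and
    -- the connection crosses the new edge.
    ... | yes p | no  _  = weaken (connected p) ◅◅ (bwd (here refl) ◅ weaken (connected q))
    ... | no  _ | yes p′ = weaken (connected q) ◅◅ (fwd (here refl) ◅ weaken (connected (sym p′)))
    ... | no  _ | no  _  = weaken (connected q)

  -- All adjacent ordered pairs are inserted. Each edge thus comes in both orientations, the second
  -- of which finds its ends already joined.
  forest-potential : ∃[ h ] ∀ {u v} → u ~ v → neg S u v ≡ h u xor h v
  forest-potential = potential , λ {u} {v} u~v → sign
    (∈-filter⁺ (T? ∘ uncurry (adj G)) (∈-cartesianProduct⁺ (∈-allFin u) (∈-allFin v)) u~v)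
    where
    open Potential (potentials
      (all-filter (T? ∘ uncurry (adj G)) (cartesianProduct (allFin n) (allFin n))))

-- Potentials for pairs of colour classes

-- The vertex set stays `Fin n`, vertices outside `P` becoming isolated, so potentials need no
-- reindexing.
induced : Graph n → (Fin n → Bool) → Graph n
induced G P = record
  { adj        = λ u v → adj G u v ∧ (P u ∧ P v)
  ; adj-sym    = λ u v → cong₂ _∧_ (adj-sym G u v) (∧-comm (P u) (P v))
  ; adj-irrefl = λ v → cong (_∧ (P v ∧ P v)) (adj-irrefl G v)
  }

inducedSignature : {G : Graph n} (P : Fin n → Bool) → Signature G → Signature (induced G P)
inducedSignature P S = record
  { neg     = λ u v → neg S u v ∧ (P u ∧ P v)
  ; neg-sym = λ u v → cong₂ _∧_ (neg-sym S u v) (∧-comm (P u) (P v))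
  ; neg⊆adj = λ t → let (s , p) = Equivalence.to T-∧ t in Equivalence.from T-∧ (neg⊆adj S s , p)
  }

induced-edge⁻ : (G : Graph n) (P : Fin n → Bool) → ∀ {u v} → Graph._~_ (induced G P) u v →
                Graph._~_ G u v × T (P u)
induced-edge⁻ G P {u} {v} e =
  let (u~v , p) = Equivalence.to (T-∧ {adj G u v}) e
  in u~v , proj₁ (Equivalence.to (T-∧ {P u}) p)

induced-edge⁺ : (G : Graph n) (P : Fin n → Bool) → ∀ {u v} → Graph._~_ G u v →
                T (P u) → T (P v) → Graph._~_ (induced G P) u v
induced-edge⁺ G P u~v p q = Equivalence.from T-∧ (u~v , Equivalence.from T-∧ (p , q))

module _ {A : Set} (f : Fin k → Fin k → A) where

  -- The potentials built for `(i , j)` and `(j , i)` may differ; consulting the smaller colour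
  -- first makes both ends of an edge use the same one.
  ordered : Fin k → Fin k → A
  ordered i j = if does (i <? j) then f i j else f j i

  ordered-comm : ∀ i j → ordered i j ≡ ordered j i
  ordered-comm i j with <-cmp i j
  ... | tri< i<j _ j≮i rewrite dec-true (i <? j) i<j | dec-false (j <? i) j≮i = refl
  ... | tri≈ _ refl _  = refl
  ... | tri> i≮j _ j<i rewrite dec-false (i <? j) i≮j | dec-true (j <? i) j<i = refl

  ordered-elim : (P : A → Set) → ∀ {i j} → P (f i j) → P (f j i) → P (ordered i j)
  ordered-elim P {i} {j} p q with does (i <? j)
  ... | true  = p
  ... | false = q

pigeonhole₂ : ∀ {A : Set} {i j x y z : A} → x ≡ i ⊎ x ≡ j → y ≡ i ⊎ y ≡ j → z ≡ i ⊎ z ≡ j →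
              x ≡ y ⊎ x ≡ z ⊎ y ≡ z
pigeonhole₂ (inj₁ refl) (inj₁ refl) _           = inj₁ refl
pigeonhole₂ (inj₂ refl) (inj₂ refl) _           = inj₁ refl
pigeonhole₂ (inj₁ refl) (inj₂ refl) (inj₁ refl) = inj₂ (inj₁ refl)
pigeonhole₂ (inj₁ refl) (inj₂ refl) (inj₂ refl) = inj₂ (inj₂ refl)
pigeonhole₂ (inj₂ refl) (inj₁ refl) (inj₁ refl) = inj₂ (inj₂ refl)
pigeonhole₂ (inj₂ refl) (inj₁ refl) (inj₂ refl) = inj₂ (inj₁ refl)

module _ {G : Graph n} (φ : AcyclicColoring G k) where
  open Graph G using (_~_)
  open AcyclicColoring φ

  hasColor : Fin k → Fin k → Fin n → Bool
  hasColor i j u = does (color u ≟ i) ∨ does (color u ≟ j)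

  hasColor⁻ : ∀ i j u → T (hasColor i j u) → color u ≡ i ⊎ color u ≡ j
  hasColor⁻ i j u t with color u ≟ i | color u ≟ j
  ... | yes p | _     = inj₁ p
  ... | no  _ | yes q = inj₂ q

  hasColor⁺ : ∀ i j u → color u ≡ i ⊎ color u ≡ j → T (hasColor i j u)
  hasColor⁺ i j u (inj₁ p) rewrite dec-true (color u ≟ i) p = _
  hasColor⁺ i j u (inj₂ q) rewrite dec-true (color u ≟ j) q =
    Equivalence.from (T-∨ {does (color u ≟ i)}) (inj₂ _)

  bichromatic : Fin k → Fin k → Graph n
  bichromatic i j = induced G (hasColor i j)

  -- Such a cycle is also a cycle of `G`, hence shows three distinct colours, while each of its
  -- vertices has colour `i` or `j`.
  bichromatic-acyclic : ∀ i j → ¬ Cycle (bichromatic i j)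
  bichromatic-acyclic i j C =
    let (x , y , z , x∈ , y∈ , z∈ , x≢y , x≢z , y≢z) = acyclic cycle
    in [ x≢y , [ x≢z , y≢z ]′ ]′ (pigeonhole₂ (two-colors x∈) (two-colors y∈) (two-colors z∈))
    where
    open Cycle C

    cycle : Cycle G
    cycle = record
      { v = v ; vs = vs ; long = long ; distinct = distinct
      ; closed = Linked.map (proj₁ ∘ induced-edge⁻ G (hasColor i j)) closed }

    two-colors : ∀ {x} → x ∈ v ∷ vs → color x ≡ i ⊎ color x ≡ j
    two-colors {x} x∈ =
      let (_ , e) = All.lookup (linked-init (v ∷ vs) closed) x∈
      in hasColor⁻ i j x (proj₂ (induced-edge⁻ G (hasColor i j) e))

  module _ (S : Signature G) where

    pairPotential : ∀ i j → ∃[ h ] ∀ {u v} → u ~ v → T (hasColor i j u) → T (hasColor i j v) →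
                    neg S u v ≡ h u xor h v
    pairPotential i j =
      let (h , sign) = forest-potential (bichromatic i j) (bichromatic-acyclic i j)
                         (inducedSignature (hasColor i j) S)
      in h , λ {u} {v} u~v p q → trans
        -- Both ends carry one of the two colours, so restricting the signature leaves this sign
        -- intact.
        (sym (trans (cong (neg S u v ∧_) (Equivalence.to T-≡ (Equivalence.from T-∧ (p , q))))
                    (∧-identityʳ (neg S u v))))
        (sign (induced-edge⁺ G (hasColor i j) u~v p q))

    bichromaticPotential : Fin k → Fin k → Fin n → Bool
    bichromaticPotential = ordered λ i j → proj₁ (pairPotential i j)

    bichromaticPotential-sign : ∀ {u v} → u ~ v →
      let h = bichromaticPotential (color u) (color v) in neg S u v ≡ h u xor h v
    bichromaticPotential-sign {u} {v} u~v =
      ordered-elim (λ i j → proj₁ (pairPotential i j)) (λ h → neg S u v ≡ h u xor h v)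
        (proj₂ (pairPotential (color u) (color v)) u~v
          (hasColor⁺ (color u) (color v) u (inj₁ refl))
          (hasColor⁺ (color u) (color v) v (inj₂ refl)))
        (proj₂ (pairPotential (color v) (color u)) u~v
          (hasColor⁺ (color v) (color u) u (inj₂ refl))
          (hasColor⁺ (color v) (color u) v (inj₁ refl)))

-- The signed homomorphism

bit : Bool → Fin 2
bit = Inverse.from 2↔Bool

bit-injective : ∀ {x y} → bit x ≡ bit y → x ≡ y
bit-injective {x} {y} q =
  trans (sym (Inverse.strictlyInverseˡ 2↔Bool x))
        (trans (cong (Inverse.to 2↔Bool) q) (Inverse.strictlyInverseˡ 2↔Bool y))

funToFin-injective : ∀ {m n} {f g : Fin m → Fin n} → funToFin f ≡ funToFin g → ∀ x → f x ≡ g x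
funToFin-injective {f = f} {g} q x =
  trans (sym (finToFun-funToFin f x)) (trans (cong (λ i → finToFun i x) q) (finToFun-funToFin g x))

module _ {G : Graph n} (S : Signature G)
         (color : Fin n → Fin (2 + k)) (h : Fin (2 + k) → Fin (2 + k) → Fin n → Bool) where
  open Graph G using (_~_)

  private
    -- `punchIn i zero` is the least colour other than `i`; its bit is the one that resigning makes
    -- zero.
    reference : Fin (2 + k) → Fin n → Bool
    reference i = h i (punchIn i zero)

    X : Subset n
    X = tabulate λ u → reference (color u) u

    residual : Fin (2 + k) → Fin n → Bool
    residual j u = h (color u) j u xor reference (color u) u

    -- `suc b` skips the reference colour, whose residual bit is always `false`; `k` of the `1 + k`
    -- other colours remain.
    bits : Fin n → Fin k → Fin 2
    bits u b = bit (residual (punchIn (color u) (suc b)) u)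

    target : Fin n → Fin ((2 + k) * 2 ^ k)
    target u = combine (color u) (funToFin (bits u))

    target-color : ∀ {u v} → target u ≡ target v → color u ≡ color v
    target-color {u} {v} = proj₁ ∘ combine-injective (color u) _ (color v) _

    target-residual-punchIn : ∀ {u v} → target u ≡ target v → ∀ b →
      residual (punchIn (color u) b) u ≡ residual (punchIn (color v) b) v
    target-residual-punchIn {u} {v} q zero =
      trans (xor-same (reference (color u) u)) (sym (xor-same (reference (color v) v)))
    target-residual-punchIn {u} {v} q (suc b) = bit-injective
      (funToFin-injective (proj₂ (combine-injective (color u) _ (color v) _ q)) b)

    -- The bits are numbered relative to the vertex's own colour; equal targets have equal colours,
    -- so the numberings agree.
    target-residual : ∀ {u v j} → target u ≡ target v → color u ≢ j → residual j u ≡ residual j v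
    target-residual {u} {v} {j} q u≢j = begin
      residual j u                     ≡⟨ cong (λ i → residual i u) (punchIn-punchOut u≢j) ⟨
      residual (punchIn (color u) b) u ≡⟨ target-residual-punchIn q b ⟩
      residual (punchIn (color v) b) v ≡⟨ cong (λ i → residual (punchIn i b) v) (target-color q) ⟨
      residual (punchIn (color u) b) v ≡⟨ cong (λ i → residual i v) (punchIn-punchOut u≢j) ⟩
      residual j v                     ∎
      where
      open ≡-Reasoning
      b = punchOut u≢j

  -- After resigning, the sign of `uv` is the sum of two residual bits, each determined by the
  -- target of one end and the colour of the other. Hence `target` is compatible, and its image is
  -- the required signified graph.
  mapsToOrder : (∀ {u v} → u ~ v → color u ≢ color v) →
                (∀ i j → h i j ≡ h j i) →
                (∀ {u v} → u ~ v → neg S u v ≡ h (color u) (color v) u xor h (color u) (color v) v) →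
                MapsToOrder S ((2 + k) * 2 ^ k)
  mapsToOrder proper h-sym h-sign =
    imageGraph (resign X S) target c , L , resign X S , L ,
    (X , λ _ _ → refl) , Equivalent-refl L , imageHom (resign X S) target c
    where
    sign : ∀ {u v} → u ~ v →
           neg (resign X S) u v ≡ residual (color v) u xor residual (color u) v
    sign {u} {v} u~v = begin
      neg (resign X S) u v                          ≡⟨ resign-edge {G = G} X S u~v ⟩
      neg S u v xor (lookup X u xor lookup X v)     ≡⟨ cong₂ (λ x y → neg S u v xor (x xor y))
                                                         (lookup∘tabulate _ u) (lookup∘tabulate _ v) ⟩
      neg S u v xor (r xor s)                       ≡⟨ cong (_xor (r xor s)) (h-sign u~v) ⟩
      (hᵤᵥ u xor hᵤᵥ v) xor (r xor s)               ≡⟨ solve 4 (λ x y z w → (x :+ y) :+ (z :+ w) := (x :+ z) :+ (y :+ w))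
                                                         refl (hᵤᵥ u) (hᵤᵥ v) r s ⟩
      -- The residual at `v` takes the colour of `v` as first index of `h`, so the indices must be
      -- swapped there.
      (hᵤᵥ u xor r) xor (hᵤᵥ v xor s)               ≡⟨ cong (λ f → (hᵤᵥ u xor r) xor (f v xor s))
                                                         (h-sym (color u) (color v)) ⟩
      residual (color v) u xor residual (color u) v ∎
      where
      open ≡-Reasoning
      open xor-∧-Solver
      hᵤᵥ = h (color u) (color v)
      r = reference (color u) u
      s = reference (color v) v

    signs : ∀ u v u′ v′ → u ~ v → u′ ~ v′ → target u ≡ target u′ → target v ≡ target v′ →
            neg (resign X S) u v ≡ neg (resign X S) u′ v′
    signs u v u′ v′ e e′ p q = begin
      neg (resign X S) u v                              ≡⟨ sign e ⟩
      residual (color v) u xor residual (color u) v     ≡⟨ cong₂ _xor_ (target-residual p (proper e))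
                                                             (target-residual q (proper e ∘ sym)) ⟩
      residual (color v) u′ xor residual (color u) v′   ≡⟨ cong₂ (λ i j → residual i u′ xor residual j v′)
                                                             (target-color q) (target-color p) ⟩
      residual (color v′) u′ xor residual (color u′) v′ ≡⟨ sign e′ ⟨
      neg (resign X S) u′ v′                            ∎
      where open ≡-Reasoning

    c : Compatible (resign X S) target
    c = (λ u v e q → proper e (target-color q)) , signs

    L : Signature (imageGraph (resign X S) target c)
    L = imageSignature (resign X S) target c

-- The bound on the signed chromatic number

χₛ-≤ : ∀ {m} (G : Graph n) → (∀ (S : Signature G) → MapsToOrder S m) → χₛ G ≤ m
-- The maximum is attained at some signature `S`, and the minimum for `S` is at most `m` by `f S`.
χₛ-≤ G f = IsMaximum⇒≤ {IsValue G} (χₛ-isMaximum G)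
  λ { _ (S , refl) → IsMinimum⇒≤ {MapsToOrder S} (χₛ-signed-isMinimum S) (f S) }
  where
  IsMaximum⇒≤ : ∀ {P m b} → IsMaximum P m → (∀ j → P j → j ≤ b) → m ≤ b
  IsMaximum⇒≤ (Pm , _) bound = bound _ Pm

  IsMinimum⇒≤ : ∀ {P m j} → IsMinimum P m → P j → m ≤ j
  IsMinimum⇒≤ (_ , least) Pj = least _ Pj

mainTheorem16 : ∀ (n k : ℕ) → 2 ≤ k → (G : Graph n) → AcyclicColoring G k → χₛ G ≤ k * 2 ^ (k ∸ 2)
-- Matching on `2 ≤ k` turns the exponent into the number of bits that remain.
mainTheorem16 n (suc (suc k)) (s≤s (s≤s z≤n)) G φ = χₛ-≤ G λ S →
  mapsToOrder S color (bichromaticPotential φ S) proper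
    (ordered-comm λ i j → proj₁ (pairPotential φ S i j)) (bichromaticPotential-sign φ S)
  where open AcyclicColoring φ
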